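{- Let $Eq_\infty$ be the countable equality function on $2^\omega$, given (identifying elements of $2^\omega=\{0,1\}^{\mathbb{N}}$ with subsets of $\mathbb{N}$) by $Eq_\infty(A,B)=\{n\mid\forall m\,([n,m]\in A\Leftrightarrow[n,m]\in B)\}$, regarded as a function $2^\omega\to2^\omega$ on coded pairs. (a) The set $2^\omega$ cannot be written as a countable union $\bigcup_{i\in\mathbb{N}}V_i$ such that $Eq_\infty$ is Cantor continuous on each $V_i$ (i.e. each restriction of $Eq_\infty$ to $V_i$ with the subspace topology is continuous for the Cantor topology). (b) The function $Eq_\infty$ is, relative to the pca $2^\omega$, not computable in any function $F:2^\omega\to2^\omega$ with countable image; i.e. for every such $F$, $Eq_\infty$ is not representable in $2^\omega[F]$.
   Context: A partial combinatory algebra (pca) is a set $\mathcal{A}$ with a partial binary application $(a,b)\mapsto ab$ (associating to the left) such that there are $\mathsf{k},\mathsf{s}\in\mathcal{A}$ with, for all $a,b,c$: $\mathsf{k}ab=a$; $\mathsf{s}ab$ is defined; and whenever $(ac)(bc)$ is defined, $\mathsf{s}abc$ is defined and equals $(ac)(bc)$. A partial function $f:\mathcal{A}\to\mathcal{A}$ is representable in $\mathcal{A}$ if there is $a_f\in\mathcal{A}$ with $a_fa=f(a)$ for all $a$ in the domain of $f$. Every pca contains booleans $\mathsf{T},\mathsf{F}$ with a definition-by-cases element $D$ ($D\mathsf{T}ab=a$, $D\mathsf{F}ab=b$), and standard codings $[a,b]$ of pairs and $[a_0,\ldots,a_{n-1}]$ of finite sequences whose basic operations (length, projections, appending) are representable;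 fix such choices. For a pca $\mathcal{A}$ and a partial function $f:\mathcal{A}\to\mathcal{A}$, $\mathcal{A}[f]$ is the pca with underlying set $\mathcal{A}$ and application $\cdot_f$ defined by: $a\cdot_f b=c$ iff there is a finite sequence $e_0,\ldots,e_{n-1}$ in $\mathcal{A}$ (on each of which $f$ is defined) such that $a[b,f(e_0),\ldots,f(e_{i-1})]=[\mathsf{F},e_i]$ for all $i<n$ and $a[b,f(e_0),\ldots,f(e_{n-1})]=[\mathsf{T},c]$. The pca $2^\omega$: underlying set $\{0,1\}^{\mathbb{N}}$; $\alpha\cdot\beta$ is defined iff for every $n$ there is $k$ with $\alpha([n,\beta(0),\ldots,\beta(k-1)])=1$ (with $[\cdot,\ldots,\cdot]$ a standard coding of finite sequences of naturals by naturals), and then $(\alpha\cdot\beta)(n)=\alpha([n,\beta(0),\ldots,\beta(k)])$ for the least such $k$. Elements $\alpha$ of $2^\omega$ are identified with subsets $\{n\mid\alpha(n)=1\}$ of $\mathbb{N}$; $[\cdot,\cdot]$ on $\mathbb{N}$ is a standard bijective pairing. The pairing on $2^\omega$ may be taken to be the homeomorphism $(A,B)\mapsto\{2n\mid n\in A\}\cup\{2n+1\mid n\in B\}$. The Cantor topology on $2^\omega$ is the product topology of discrete copies of $\{0,1\}$; a partial function on $2^\omega$ is representable in the pca $2^\omega$ iff it is Cantor continuous on its domain. -}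

module Defs where

open import Axiom.ExcludedMiddle using (ExcludedMiddle)
open import Data.Bool.Base using (Bool; true; false; if_then_else_)
open import Data.Fin.Base using (Fin; toℕ)
open import Data.List.Base using (List; []; _∷_; applyUpTo; tabulate; take)
open import Data.List.Membership.Propositional using () renaming (_∈_ to _∈ˡ_)
open import Data.Nat.Base
open import Data.Nat.DivMod using (_/_; _%_)
open import Data.Product.Base using (∃; ∃-syntax; _×_)
open import Function.Base using (_∘_)
open import Function.Bundles using (_⇔_; Func)
open import Level using (0ℓ)
open import Relation.Binary.Bundles using (Setoid)
open import Relation.Binary.Core using (Rel)
open import Relation.Binary.PropositionalEquality
  using (_≡_; _≗_; _→-setoid_)
open import Relation.Nullary.Decidable.Core using (does)
open import Relation.Unary using (Pred; _∈_)

-- A partial binary operation is given by its graph: app a b c says that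
-- ab is defined and equal to c.
Application : Set → Set₁
Application A = A → A → A → Set

-- Partial functions, too, are given by their graphs.
PartialFunction : Set → Set₁
PartialFunction A = Rel A 0ℓ

Representable : {A : Set} → Application A → PartialFunction A → Set
Representable app f = ∃[ a ] (∀ x y → f x y → app a x y)

record Coding (A : Set) : Set where
  field
    T F   : A
    ⟨_,_⟩ : A → A → A
    ⟦_⟧   : List A → A

-- The application of A[f].  The queries are e₀,…,eₙ₋₁ and the answers are
-- r i = f(e i); take (toℕ i) keeps exactly the answers before the i-th.
adjoin : {A : Set} → Application A → Coding A → PartialFunction A → Application A
adjoin {A} app coding f a b c =
  ∃ λ (n : ℕ) → ∃ λ (e : Fin n → A) → ∃ λ (r : Fin n → A) →
    (∀ i → f (e i) (r i)) ×
    (∀ i → app a ⟦ b ∷ take (toℕ i) (tabulate r) ⟧ ⟨ F , e i ⟩) ×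
    app a ⟦ b ∷ tabulate r ⟧ ⟨ T , c ⟩
  where open Coding coding

-- The bijection (n , m) ↦ 2ⁿ(2m + 1) − 1.
pair : ℕ → ℕ → ℕ
pair n m = 2 ^ n * suc (2 * m) ∸ 1

-- A bijection between finite sequences of naturals and ℕ.
encode : List ℕ → ℕ
encode []       = 0
encode (x ∷ xs) = suc (pair x (encode xs))

-- Equality of elements of 2^ω is pointwise.
2^ωₛ : Setoid 0ℓ 0ℓ
2^ωₛ = ℕ →-setoid Bool

2^ω : Set
2^ω = ℕ → Bool

_∈ω_ : ℕ → 2^ω → Set
n ∈ω A = A n ≡ true

bit : Bool → ℕ
bit b = if b then 1 else 0

-- [n, β(0), …, β(k−1)]
segment : ℕ → 2^ω → ℕ → ℕ
segment n β k = encode (n ∷ applyUpTo (bit ∘ β) k)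

-- Being defined for every n amounts to the existence of γ.
2^ω-app : Application 2^ω
2^ω-app α β γ = ∀ n → ∃[ k ]
  α (segment n β k) ≡ true ×
  (∀ j → j < k → α (segment n β j) ≡ false) ×
  γ n ≡ α (segment n β (suc k))

-- { 2n ∣ n ∈ A } ∪ { 2n + 1 ∣ n ∈ B }
join : 2^ω → 2^ω → 2^ω
join A B k = if k % 2 ≡ᵇ 0 then A (k / 2) else B (k / 2)

evens odds : 2^ω → 2^ω
evens X n = X (2 * n)
odds  X n = X (2 * n + 1)

-- Booleans are told apart by any single bit, and a sequence is a nested pair
-- in which T announces a further entry and F the end, so that definition by
-- cases, length, projections and appending are Cantor continuous on codes,
-- i.e. representable.
2^ω-coding : Coding 2^ω
2^ω-coding = record { T = T ; F = F ; ⟨_,_⟩ = join ; ⟦_⟧ = seq }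
  where
  T F : 2^ω
  T _ = true
  F _ = false

  seq : List 2^ω → 2^ω
  seq []       = join F F
  seq (A ∷ As) = join T (join A (seq As))

graph : (2^ω → 2^ω) → PartialFunction 2^ω
graph f X Y = f X ≗ Y

-- The application of 2^ω[F].
2^ω[_] : Func 2^ωₛ 2^ωₛ → Application 2^ω
2^ω[ F ] = adjoin 2^ω-app 2^ω-coding (graph (Func.to F))

Subset : Set₁
Subset = Pred 2^ω 0ℓ

-- The product topology: around each of its points, U contains a basic open
-- set, obtained by fixing finitely many coordinates.
Open : Subset → Set
Open U = ∀ A → A ∈ U →
  ∃ λ (J : List ℕ) → (∀ B → (∀ j → j ∈ˡ J → B j ≡ A j) → B ∈ U)

-- Preimages of open sets are open in the subspace topology of V.
ContinuousOn : Subset → (2^ω → 2^ω) → Set₁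
ContinuousOn V f = ∀ U → Open U →
  ∃ λ (W : Subset) → Open W × (∀ A → A ∈ V → (f A ∈ U ⇔ A ∈ W))

Image : Func 2^ωₛ 2^ωₛ → Subset
Image F Y = ∃[ X ] Func.to F X ≗ Y

Countable : Subset → Set
Countable P = ∃ λ (c : ℕ → 2^ω) → ∀ Y → Y ∈ P → ∃[ i ] Y ≗ c i

-- As a function into 2^ω this needs a classical metatheory: deciding
-- whether two rows agree everywhere is not constructively possible.
module _ (em : ExcludedMiddle 0ℓ) where

  eq∞ : 2^ω → 2^ω → 2^ω
  eq∞ A B n = does (em {∀ m → pair n m ∈ω A ⇔ pair n m ∈ω B})

  -- On coded pairs.  As join is a bijection with inverse (evens , odds),
  -- every X is the code of exactly one pair.
  Eq∞ : 2^ω → 2^ω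
  Eq∞ X = eq∞ (evens X) (odds X)

{-# OPTIONS --safe #-}

-- Restricted to codes of pairs (A , ∅), Eq∞ tells which rows of A are empty.
--
-- For (a), a point A with (A , ∅) outside every V i is built by finite
-- approximations, each fixing finitely many bits and finitely many full rows.
-- At stage i take an unconstrained row.  If no member of V i is compatible with
-- the approximation and has that row empty, make the row empty.  Otherwise pick
-- such a member; by continuity, finitely many of its bits force the row to be
-- empty for members of V i.  Adopt these bits and put a 1 further out in the row.
--
-- For (b), with the answers of F to the queries held fixed, the output of a
-- computation in 2^ω[F] depends continuously on the input.  If the image of F
-- is countable, there are only countably many finite sequences of answers, so
-- 2^ω would be a countable union of sets as excluded by (a).

module Submission where

open import Defs
open import Axiom.ExcludedMiddle using (ExcludedMiddle)
open import Data.Bool.Base using (Bool; true; false; if_then_else_)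
open import Data.Bool.Properties using (not-¬)
open import Data.Fin.Base using (Fin)
open import Data.List.Base using (List; []; _∷_; applyUpTo; map; tabulate)
open import Data.List.Extrema.Nat using (max; xs≤max)
open import Data.List.Properties using (map-tabulate)
open import Data.List.Relation.Binary.Pointwise as Pointwise
  using (Pointwise; []; _∷_)
open import Data.List.Relation.Unary.All using (lookup)
open import Data.List.Relation.Unary.Any using (here)
open import Data.Nat.Base using (ℕ; zero; suc; _+_; _*_; _∸_; _^_; _/_; _%_; _≡ᵇ_;
  _≤_; _<_; NonZero; z<s; z≤n; s≤s)
open import Data.Nat.Divisibility using (n∣m*n)
open import Data.Nat.DivMod using (m/n≤m; m*n%n≡0; m*n/n≡m; [m+kn]%n≡m%n;
  +-distrib-/-∣ʳ)
open import Data.Nat.Properties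
open import Data.Product.Base using (∃; ∃-syntax; _×_; _,_; proj₁; proj₂)
open import Data.Sum.Base using (_⊎_; inj₁; inj₂)
open import Function.Base using (_∘_)
open import Function.Bundles using (Func; Equivalence; mk⇔)
open import Level using (0ℓ)
open import Relation.Binary.Definitions using (tri<; tri≈; tri>)
open import Relation.Binary.PropositionalEquality
  using (_≡_; _≗_; refl; sym; trans; cong; cong₂; subst)
open import Relation.Nullary.Decidable using (Dec; yes; no; does; dec-true; dec-false)
open import Relation.Nullary.Negation.Core using (¬_; contradiction)
open import Relation.Unary using (Universal; ⋃; _∈_)

open Coding 2^ω-coding

-- Codings of pairs and finite sequences of naturals.

n<2^n : ∀ n → n < 2 ^ n
n<2^n zero    = z<s
n<2^n (suc n) = begin-strict
  suc n          <⟨ s≤s (n<2^n n) ⟩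
  1 + 2 ^ n      ≤⟨ +-monoˡ-≤ (2 ^ n) (m^n>0 2 n) ⟩
  2 ^ n + 2 ^ n  ≡⟨ cong (2 ^ n +_) (sym (+-identityʳ (2 ^ n))) ⟩
  2 ^ suc n      ∎
  where open ≤-Reasoning

n≤pair : ∀ n m → n ≤ pair n m
n≤pair n m = pred-mono-≤ (≤-trans (n<2^n n) (m≤m*n (2 ^ n) (suc (2 * m))))

m≤pair : ∀ n m → m ≤ pair n m
m≤pair n m = pred-mono-≤ (≤-trans (s≤s (m≤n*m m 2))
  (m≤n*m (suc (2 * m)) (2 ^ n) {{m^n≢0 2 n}}))

-- Factors of 2 are cancelled on both sides; if one side runs out first, an odd number would be
-- even.
2^n*odd-injective : ∀ n m n′ m′ → 2 ^ n * suc (2 * m) ≡ 2 ^ n′ * suc (2 * m′) →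
  n ≡ n′ × m ≡ m′
2^n*odd-injective zero m zero m′ eq =
  refl , *-cancelˡ-≡ m m′ 2 (suc-injective
    (trans (sym (*-identityˡ _)) (trans eq (*-identityˡ _))))
2^n*odd-injective zero m (suc n′) m′ eq =
  contradiction (trans (sym (*-assoc 2 (2 ^ n′) _)) (trans (sym eq) (*-identityˡ _)))
    (even≢odd (2 ^ n′ * suc (2 * m′)) m)
2^n*odd-injective (suc n) m zero m′ eq =
  contradiction (trans (sym (*-assoc 2 (2 ^ n) _)) (trans eq (*-identityˡ _)))
    (even≢odd (2 ^ n * suc (2 * m)) m′)
2^n*odd-injective (suc n) m (suc n′) m′ eq
  with 2^n*odd-injective n m n′ m′ (*-cancelˡ-≡ _ _ 2
    (trans (sym (*-assoc 2 (2 ^ n) _)) (trans eq (*-assoc 2 (2 ^ n′) _))))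
... | n≡n′ , m≡m′ = cong suc n≡n′ , m≡m′

pair-injective : ∀ n m n′ m′ → pair n m ≡ pair n′ m′ → n ≡ n′ × m ≡ m′
pair-injective n m n′ m′ eq = 2^n*odd-injective n m n′ m′
  (pred-injective {{nz n m}} {{nz n′ m′}} eq)
  where
  nz : ∀ n m → NonZero (2 ^ n * suc (2 * m))
  nz n m = m*n≢0 (2 ^ n) (suc (2 * m)) {{m^n≢0 2 n}}

encode-injective : ∀ xs ys → encode xs ≡ encode ys → xs ≡ ys
encode-injective []       []       eq = refl
encode-injective (x ∷ xs) (y ∷ ys) eq
  with pair-injective x (encode xs) y (encode ys) (suc-injective eq)
... | x≡y , eq′ = cong₂ _∷_ x≡y (encode-injective xs ys eq′)

-- Agreement on initial segments and continuity.

_≈[_]_ : 2^ω → ℕ → 2^ω → Set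
A ≈[ N ] B = ∀ j → j < N → A j ≡ B j

-- Bit `j` of a join is bit `j / 2` of a component, and `j / 2 ≤ j`, so the bound `N` survives
-- unchanged.
join-cong : ∀ {N} A A′ B B′ → A ≈[ N ] A′ → B ≈[ N ] B′ → join A B ≈[ N ] join A′ B′
join-cong A A′ B B′ A≈A′ B≈B′ j j<N with j % 2 ≡ᵇ 0
... | true  = A≈A′ (j / 2) (≤-<-trans (m/n≤m j 2) j<N)
... | false = B≈B′ (j / 2) (≤-<-trans (m/n≤m j 2) j<N)

join-even : ∀ A B k → k % 2 ≡ 0 → join A B k ≡ A (k / 2)
join-even A B k eq with k % 2
join-even A B k refl | .0 = refl

join-odd : ∀ A B k → k % 2 ≡ 1 → join A B k ≡ B (k / 2)
join-odd A B k eq with k % 2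
join-odd A B k refl | .1 = refl

evens-join : ∀ A B → evens (join A B) ≗ A
evens-join A B n = trans (cong (join A B) (*-comm 2 n))
  (trans (join-even A B (n * 2) (m*n%n≡0 n 2)) (cong A (m*n/n≡m n 2)))

odds-join : ∀ A B → odds (join A B) ≗ B
odds-join A B n =
  trans (cong (join A B) (trans (+-comm (2 * n) 1) (cong (1 +_) (*-comm 2 n))))
    (trans (join-odd A B (1 + n * 2) ([m+kn]%n≡m%n 1 n 2))
      (cong B (trans (+-distrib-/-∣ʳ 1 {n * 2} {2} (n∣m*n n)) (m*n/n≡m n 2))))

⟦⟧-cong : ∀ {N As Bs} → Pointwise _≈[ N ]_ As Bs → ⟦ As ⟧ ≈[ N ] ⟦ Bs ⟧
⟦⟧-cong [] j j<N = refl
⟦⟧-cong {As = A ∷ As} {B ∷ Bs} (A≈B ∷ As≈Bs) =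
  join-cong T T (join A ⟦ As ⟧) (join B ⟦ Bs ⟧) (λ _ _ → refl)
    (join-cong A B ⟦ As ⟧ ⟦ Bs ⟧ A≈B (⟦⟧-cong As≈Bs))

segment-cong : ∀ n k {β β′} → β ≈[ k ] β′ → segment n β k ≡ segment n β′ k
segment-cong n k β≈β′ = cong (encode ∘ (n ∷_)) (applyUpTo-cong k (λ j → cong bit ∘ β≈β′ j))
  where
  applyUpTo-cong : ∀ k {f g : ℕ → ℕ} → (∀ j → j < k → f j ≡ g j) →
    applyUpTo f k ≡ applyUpTo g k
  applyUpTo-cong zero    f≡g = refl
  applyUpTo-cong (suc k) f≡g =
    cong₂ _∷_ (f≡g 0 z<s) (applyUpTo-cong k (λ j j<k → f≡g (suc j) (s≤s j<k)))

≈-sym : ∀ {A B N} → A ≈[ N ] B → B ≈[ N ] A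
≈-sym A≈B j j<N = sym (A≈B j j<N)

≈-mono : ∀ {A B M N} → M ≤ N → A ≈[ N ] B → A ≈[ M ] B
≈-mono M≤N A≈B j j<M = A≈B j (<-≤-trans j<M M≤N)

-- Whether the search stops at `k` depends only on the first `k` bits, so inputs agreeing on `suc k`
-- bits have the same least stopping point; the output reads one bit more.
app-continuous : ∀ α β γ → 2^ω-app α β γ → ∀ n →
  ∃[ N ] (∀ β′ γ′ → 2^ω-app α β′ γ′ → β ≈[ N ] β′ → γ n ≡ γ′ n)
app-continuous α β γ αβ↓ n with αβ↓ n
... | k , stop , min , val = suc k , unique
  where
  unique : ∀ β′ γ′ → 2^ω-app α β′ γ′ → β ≈[ suc k ] β′ → γ n ≡ γ′ n
  unique β′ γ′ αβ′↓ β≈β′ with αβ′↓ n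
  ... | k′ , stop′ , min′ , val′ with <-cmp k k′
  ...   | tri< k<k′ _ _ = contradiction
          (trans (cong α (segment-cong n k (≈-mono (n≤1+n k) (≈-sym β≈β′)))) stop)
          (not-¬ (min′ k k<k′))
  ...   | tri> _ _ k′<k = contradiction
          (trans (cong α (segment-cong n k′ (≈-mono (m≤n⇒m≤1+n (<⇒≤ k′<k)) β≈β′))) stop′)
          (not-¬ (min k′ k′<k))
  ...   | tri≈ _ refl _ = trans val (trans (cong α (segment-cong n (suc k) β≈β′)) (sym val′))

app-congʳ : ∀ α β β′ γ → β ≗ β′ → 2^ω-app α β γ → 2^ω-app α β′ γ
app-congʳ α β β′ γ β≗β′ αβ↓ n with αβ↓ n
... | k , stop , min , val =
  k , trans (same k) stop , (λ j j<k → trans (same j) (min j j<k)) ,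
  trans val (sym (same (suc k)))
  where
  same : ∀ k → α (segment n β′ k) ≡ α (segment n β k)
  same k = cong α (segment-cong n k (λ j _ → sym (β≗β′ j)))

BitwiseContinuousOn : Subset → (2^ω → 2^ω) → Set
BitwiseContinuousOn V f = ∀ n X → X ∈ V →
  ∃[ N ] (∀ Y → Y ∈ V → X ≈[ N ] Y → f X n ≡ f Y n)

-- Continuity is tested on the open set that fixes bit `n` to its value in `f X`; the first
-- `suc (max 0 J)` bits cover all coordinates in `J`.
continuous⇒bitwise : ∀ {V f} → ContinuousOn V f → BitwiseContinuousOn V f
continuous⇒bitwise {V} {f} cont n X X∈V
  with cont (λ Z → f X n ≡ Z n)
    (λ Z Zn → n ∷ [] , λ Z′ agree → trans Zn (sym (agree n (here refl))))
... | W , W-open , iff with W-open X (Equivalence.to (iff X X∈V) refl)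
...   | J , J⊆W = suc (max 0 J) , λ Y Y∈V X≈Y →
  Equivalence.from (iff Y Y∈V)
    (J⊆W Y (λ j j∈J → sym (X≈Y j (s≤s (lookup (xs≤max 0 J) j∈J)))))

-- Approximations and their limits.

override : {P : ℕ → Set} → (∀ j → Dec (P j)) → Bool → 2^ω → 2^ω
override P? v X j = if does (P? j) then v else X j

module _ {P : ℕ → Set} (P? : ∀ j → Dec (P j)) (v : Bool) (X : 2^ω) where

  override-in : ∀ {j} → P j → override P? v X j ≡ v
  override-in {j} p with P? j
  ... | yes _ = refl
  ... | no ¬p = contradiction p ¬p

  override-out : ∀ {j} → ¬ P j → override P? v X j ≡ X j
  override-out {j} ¬p with P? j
  ... | yes p = contradiction p ¬p
  ... | no _  = refl

-- An approximation (X , K) fixes the first K bits and the first K rows to be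
-- those of X.
Fixed : ℕ → ℕ → Set
Fixed K j = j < K ⊎ (∃[ n ] ∃[ m ] n < K × j ≡ pair n m)

Extends : 2^ω → ℕ → 2^ω → Set
Extends X K A = ∀ j → Fixed K j → A j ≡ X j

Fixed-mono : ∀ {K L j} → K ≤ L → Fixed K j → Fixed L j
Fixed-mono K≤L (inj₁ j<K) = inj₁ (<-≤-trans j<K K≤L)
Fixed-mono K≤L (inj₂ (n , m , n<K , eq)) = inj₂ (n , m , <-≤-trans n<K K≤L , eq)

-- Makes row `K` available to the next stage: its entries lie at or beyond position `K`, and
-- distinct rows are disjoint.
row-free : ∀ K m → ¬ Fixed K (pair K m)
row-free K m (inj₁ p<K) = <⇒≱ p<K (n≤pair K m)
row-free K m (inj₂ (n , m′ , n<K , eq)) =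
  <⇒≢ n<K (sym (proj₁ (pair-injective K m n m′ eq)))

module _ (X : ℕ → 2^ω) (K : ℕ → ℕ) (K-mono : ∀ i → K i < K (suc i))
         (X-extends : ∀ i → Extends (X i) (K i) (X (suc i))) where

  -- As `K` increases strictly, `j < K (suc j)`, so bit `j` no longer changes from stage `suc j` on.
  limit : 2^ω
  limit j = X (suc j) j

  private
    K-inflationary : ∀ i → i ≤ K i
    K-inflationary zero    = z≤n
    K-inflationary (suc i) = ≤-<-trans (K-inflationary i) (K-mono i)

    stable : ∀ i d → K i ≤ K (d + i) × Extends (X i) (K i) (X (d + i))
    stable i zero    = ≤-refl , λ _ _ → refl
    stable i (suc d) with stable i d
    ... | K≤ , ext = ≤-trans K≤ (<⇒≤ (K-mono (d + i))) ,
      λ j fixed → trans (X-extends (d + i) j (Fixed-mono K≤ fixed)) (ext j fixed)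

    stable≤ : ∀ {i i′} → i ≤ i′ → Extends (X i) (K i) (X i′)
    stable≤ {i} {i′} i≤i′ =
      subst (Extends (X i) (K i) ∘ X) (m∸n+n≡m i≤i′) (proj₂ (stable i (i′ ∸ i)))

  -- If `i ≤ suc j`, stage `suc j` inherits what stage `i` fixes; otherwise stage `i` inherits bit
  -- `j` from stage `suc j`.
  limit-extends : ∀ i → Extends (X i) (K i) limit
  limit-extends i j fixed with ≤-total i (suc j)
  ... | inj₁ i≤1+j = stable≤ i≤1+j j fixed
  ... | inj₂ 1+j≤i = sym (stable≤ 1+j≤i j (inj₁ (K-inflationary (suc j))))

-- Diagonalisation against a countable cover.

module _ (em : ExcludedMiddle 0ℓ) where

  private
    ∅ : 2^ω
    ∅ _ = false

    code : 2^ω → 2^ω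
    code A = join A ∅

    RowEmpty : ℕ → 2^ω → Set
    RowEmpty n A = ∀ m → A (pair n m) ≡ false

    emptyRow⇒Eq∞ : ∀ n A → RowEmpty n A → Eq∞ em (code A) n ≡ true
    emptyRow⇒Eq∞ n A empty = dec-true em λ m → mk⇔
      (λ ∈A → contradiction
        (trans (sym (evens-join A ∅ (pair n m))) ∈A) (not-¬ (empty m)))
      (λ ∈∅ → contradiction ∈∅ (not-¬ (odds-join A ∅ (pair n m))))

    inhabitedRow⇒Eq∞ : ∀ n m A → A (pair n m) ≡ true → Eq∞ em (code A) n ≡ false
    inhabitedRow⇒Eq∞ n m A ∈A = dec-false em λ rows≡ → not-¬
      (odds-join A ∅ (pair n m))
      (Equivalence.to (rows≡ m) (trans (evens-join A ∅ (pair n m)) ∈A))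

    Avoids : Subset → 2^ω → ℕ → Set
    Avoids V X K = ∀ A → Extends X K A → ¬ (code A ∈ V)

    avoid : ∀ V → BitwiseContinuousOn V (Eq∞ em) → ∀ X K →
      ∃[ X′ ] ∃[ K′ ] K < K′ × Extends X K X′ × Avoids V X′ K′
    avoid V cont X K with em {∃[ Y ] code Y ∈ V × Extends X K Y × RowEmpty K Y}
    -- The bound `suc K` fixes row `K`, so an extension in `V` would have it empty and be the
    -- excluded member.
    ... | no ¬member = X′ , suc K , ≤-refl , X′-extends , λ A ext A∈V → ¬member
          (A , A∈V ,
           (λ j fixed → trans (ext j (Fixed-mono (n≤1+n K) fixed)) (X′-extends j fixed)) ,
           (λ m → trans (ext (pair K m) (inj₂ (K , m , ≤-refl , refl)))
                        (override-in row? false X (m , refl))))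
      where
      row? : ∀ j → Dec (∃[ m ] j ≡ pair K m)
      row? j = em

      X′ : 2^ω
      X′ = override row? false X

      X′-extends : Extends X K X′
      X′-extends j fixed = override-out row? false X
        λ { (m , refl) → row-free K m fixed }
    ... | yes (Y , Y∈V , Y-extends , empty) with cont K (code Y) Y∈V
    ...   | N , modulus =
      X′ , suc p , s≤s (n≤pair K N) , X′-extends , avoids
      where
      p : ℕ
      -- This entry of row `K` is free and lies beyond the first `N` bits, so a 1 there leaves those
      -- bits of `Y` intact; the bound `suc p` fixes both them and the 1.
      p = pair K N

      X′ : 2^ω
      X′ = override (_≟ p) true Y

      X′-extends : Extends X K X′
      X′-extends j fixed = trans
        (override-out (_≟ p) true Y λ { refl → row-free K N fixed })
        (Y-extends j fixed)

      avoids : Avoids V X′ (suc p)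
      avoids A ext A∈V = contradiction
        (trans (sym (modulus (code A) A∈V (join-cong Y A ∅ ∅ Y≈A (λ _ _ → refl))))
               (emptyRow⇒Eq∞ K Y empty))
        (not-¬ (inhabitedRow⇒Eq∞ K N A
          (trans (ext p (inj₁ ≤-refl)) (override-in (_≟ p) true Y refl))))
        where
        Y≈A : Y ≈[ N ] A
        Y≈A j j<N = sym (trans (ext j (inj₁ (m<n⇒m<1+n j<p)))
                               (override-out (_≟ p) true Y (<⇒≢ j<p)))
          where
          j<p : j < p
          j<p = <-≤-trans j<N (m≤pair K N)

  no-bitwiseContinuous-cover : (V : ℕ → Subset) → Universal (⋃ ℕ V) →
    ¬ (∀ i → BitwiseContinuousOn (V i) (Eq∞ em))
  no-bitwiseContinuous-cover V cover cont =
    let i , A∈Vᵢ = cover (code A)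
        _ , _ , _ , _ , avoids = next i
    -- Approximation `suc i` is the one built to avoid `V i`, and the limit extends it.
    in  avoids A (limit-extends X K K-mono X-extends (suc i)) A∈Vᵢ
    where
    approximation : ℕ → 2^ω × ℕ
    X : ℕ → 2^ω
    K : ℕ → ℕ
    next : ∀ i → ∃[ X′ ] ∃[ K′ ] K i < K′ × Extends (X i) (K i) X′ × Avoids (V i) X′ K′

    X i = proj₁ (approximation i)
    K i = proj₂ (approximation i)
    next i = avoid (V i) (cont i) (X i) (K i)
    approximation zero    = ∅ , 0
    approximation (suc i) = proj₁ (next i) , proj₁ (proj₂ (next i))

    K-mono : ∀ i → K i < K (suc i)
    K-mono i = proj₁ (proj₂ (proj₂ (next i)))

    X-extends : ∀ i → Extends (X i) (K i) (X (suc i))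
    X-extends i = proj₁ (proj₂ (proj₂ (proj₂ (next i))))

    A : 2^ω
    A = limit X K K-mono X-extends

-- Computations relative to a function with countable image.

-- The inputs on which α returns f when the answers to its queries are c(i), i ∈ σ.
Computed : 2^ω → (ℕ → 2^ω) → (2^ω → 2^ω) → List ℕ → Subset
Computed α c f σ X = 2^ω-app α ⟦ X ∷ map c σ ⟧ ⟨ T , f X ⟩

computed-continuous : ∀ α c f σ → BitwiseContinuousOn (Computed α c f σ) f
computed-continuous α c f σ n X X∈
  -- Bit `n` of `f X` sits at position `2 * n + 1` of `⟨ T , f X ⟩`.
  with app-continuous α ⟦ X ∷ map c σ ⟧ ⟨ T , f X ⟩ X∈ (2 * n + 1)
... | N , unique = N , λ Y Y∈ X≈Y →
  trans (sym (odds-join T (f X) n))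
    (trans (unique ⟦ Y ∷ map c σ ⟧ ⟨ T , f Y ⟩ Y∈
      (⟦⟧-cong {Bs = Y ∷ map c σ} (X≈Y ∷ Pointwise.refl (λ _ _ → refl))))
      (odds-join T (f Y) n))

-- Every answer lies in the image of `F` and so has an index under `c`; these indices form `σ`.
-- Answers equal their enumerated copies only pointwise, hence `app-congʳ`.
representable⇒computed : ∀ F α c f →
  (∀ Y → Y ∈ Image F → ∃[ i ] Y ≗ c i) →
  (∀ X Y → graph f X Y → 2^ω[ F ] α X Y) →
  ∀ X → ∃[ σ ] X ∈ Computed α c f σ
representable⇒computed F α c f enum repr X with repr X (f X) (λ _ → refl)
... | n , e , r , answers , _ , result =
  tabulate index , app-congʳ α ⟦ X ∷ tabulate r ⟧ ⟦ X ∷ map c (tabulate index) ⟧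
    ⟨ T , f X ⟩ same result
  where
  index : Fin n → ℕ
  index i = proj₁ (enum (r i) (e i , answers i))

  same : ⟦ X ∷ tabulate r ⟧ ≗ ⟦ X ∷ map c (tabulate index) ⟧
  same j rewrite map-tabulate index c =
    ⟦⟧-cong {suc j} {X ∷ tabulate r} {X ∷ tabulate (c ∘ index)} ((λ _ _ → refl) ∷ Pointwise.tabulate⁺
      (λ i k _ → proj₂ (enum (r i) (e i , answers i)) k)) j ≤-refl

theorem3p4 : (em : ExcludedMiddle 0ℓ) →
    (¬ (∃ λ (V : ℕ → Subset) →
    Universal (⋃ ℕ V) ×
    (∀ i → ContinuousOn (V i) (Eq∞ em))))
    ×
    ((F : Func 2^ωₛ 2^ωₛ) → Countable (Image F) →
    ¬ Representable 2^ω[ F ] (graph (Eq∞ em)))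
theorem3p4 em =
  (λ (V , cover , cont) →
    no-bitwiseContinuous-cover em V cover (continuous⇒bitwise ∘ cont)) ,
  λ F (c , enum) (α , repr) →
    no-bitwiseContinuous-cover em
      -- Answer sequences are indexed by their codes. As `encode` is injective, points of one set
      -- share their sequence, so `computed-continuous` applies.
      (λ i X → ∃[ σ ] encode σ ≡ i × X ∈ Computed α c (Eq∞ em) σ)
      (λ X → let σ , X∈ = representable⇒computed F α c (Eq∞ em) enum repr X
             in  encode σ , σ , refl , X∈)
      λ i n X (σ , code≡ , X∈) →
        let N , modulus = computed-continuous α c (Eq∞ em) σ n X X∈
        in  N , λ Y (τ , code≡′ , Y∈) → modulus Y
              (subst (λ ρ → Y ∈ Computed α c (Eq∞ em) ρ)
                (encode-injective τ σ (trans code≡′ (sym code≡))) Y∈)
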